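{- Let $p>1$ be an integer, let $\phi\ge 1$ be real, and let $\mathcal{B}(\phi)=[p/(2\phi-1),\,p(2\phi-1)]$. For every integer $b\ge1$, let $A(b)$ be the deterministic ski-rental algorithm with $b$ renting days. The policy class of $\phi$-degraded algorithms for the ski-rental problem (with baseline $A(p)$) is determined by $\mathcal{B}(\phi)$; that is, for every integer $b\ge 1$ with $b\in\mathcal{B}(\phi)$ the degradation factor of $A(b)$ with respect to $A(p)$ is at most $\phi$: $$\mathrm{CR}(A(b))\le \phi\,\mathrm{CR}(A(p)).$$
   Context: Ski-rental problem: a skier skis for an unknown number $x\in\{1,2,\dots\}$ of days. On each day the skier can rent skis at cost $1$, or buy them at the integer price $p>1$ and ski for free from then on. The offline optimal cost is $\min(x,p)$. Algorithm $A(b)$: rent for the first $b$ days, and buy on the next day if skiing continues. Thus its cost is $x$ if $x\le b$ and $b+p$ if $x>b$. The algorithm $A(p)$ is the $2$-competitive baseline. The competitive ratio $\mathrm{CR}(A)$ is the supremum over all $x\ge1$ of the cost of $A$ divided by the offline optimal cost. The degradation factor $\mathrm{DF}(A(b))$ relative to the baseline $A(p)$ is a factor satisfying $\mathrm{CR}(A(b))\le \mathrm{DF}(A(b))\,\mathrm{CR}(A(p))$. A class of algorithms is $\phi$-degraded if every algorithm in it has degradation factor at most $\phi$. -}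

module Defs where

open import Data.Bool.Base using (if_then_else_)
open import Data.Integer.Base using (+_)
open import Data.Nat.Base as ℕ using (ℕ; suc; NonZero; NonTrivial)
import Data.Nat.Properties as ℕ
open import Data.Product.Base using (Σ; ∃-syntax; _×_; _,_)
open import Data.Rational.Base as ℚ using (ℚ; 0ℚ; 1ℚ; ½; ∣_∣; _/_)
import Data.Rational.Properties as ℚ
open import Data.Rational.Solver using (module +-*-Solver)
open import Level using (0ℓ)
open import Relation.Binary.PropositionalEquality
open import Relation.Nullary.Decidable using (⌊_⌋; yes; no)
open import Relation.Nullary.Negation using (contradiction)
open import Relation.Unary using (Pred)

------------------------------------------------------------------------
-- Real numbers: Cauchy sequences of rationals with a modulus of
-- convergence.  There is no quotient; equality of reals is _≤_ in both
-- directions.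

IsCauchy : (ℕ → ℚ) → Set
IsCauchy f = ∀ ε → 0ℚ ℚ.< ε →
  ∃[ N ] ∀ m n → N ℕ.≤ m → N ℕ.≤ n → ∣ f m ℚ.- f n ∣ ℚ.≤ ε

record ℝ : Set where
  constructor mkℝ
  field
    seq    : ℕ → ℚ
    cauchy : IsCauchy seq

open ℝ public

infix  4 _≤_ _<_
infixl 6 _+_ _-_
infixl 7 _*_
infix  8 -_

_≤_ : ℝ → ℝ → Set
x ≤ y = ∀ ε → 0ℚ ℚ.< ε →
  ∃[ N ] ∀ n → N ℕ.≤ n → seq x n ℚ.≤ seq y n ℚ.+ ε

-- The gap δ must be uniform: eventual pointwise strictness would not
-- separate the limits.
_<_ : ℝ → ℝ → Set
x < y = ∃[ δ ] 0ℚ ℚ.< δ ×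
  ∃[ N ] ∀ n → N ℕ.≤ n → seq x n ℚ.+ δ ℚ.≤ seq y n

-- Total on ℚ, with value 0 at 0, so that reciprocals of sequences can be
-- taken termwise.
recip : ℚ → ℚ
recip q with q ℚ.≟ 0ℚ
... | yes _   = 0ℚ
... | no  q≢0 = (ℚ.1/ q) {{ℚ.≢-nonZero q≢0}}

recip-inverseʳ : ∀ q → q ≢ 0ℚ → q ℚ.* recip q ≡ 1ℚ
recip-inverseʳ q q≢0 with q ℚ.≟ 0ℚ
... | yes q≡0 = contradiction q≡0 q≢0
... | no  q≢0′ = ℚ.*-inverseʳ q {{ℚ.≢-nonZero q≢0′}}

recip-pos : ∀ q → 0ℚ ℚ.< q → 0ℚ ℚ.< recip q
recip-pos q 0<q with q ℚ.≟ 0ℚ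
... | yes q≡0 = contradiction (sym q≡0) (ℚ.<⇒≢ 0<q)
... | no  q≢0 = ℚ.positive⁻¹ _ {{ℚ.1/pos⇒pos q {{ℚ.positive 0<q}}}}

private
  0<½ : 0ℚ ℚ.< ½
  0<½ = ℚ.positive⁻¹ ½

  0<* : ∀ {p q} → 0ℚ ℚ.< p → 0ℚ ℚ.< q → 0ℚ ℚ.< p ℚ.* q
  0<* {p} {q} 0<p 0<q = ℚ.positive⁻¹ (p ℚ.* q)
    {{ℚ.pos*pos⇒pos p {{ℚ.positive 0<p}} q {{ℚ.positive 0<q}}}}

  *-mono-≤ : ∀ {p q r s} → 0ℚ ℚ.≤ r → 0ℚ ℚ.≤ q →
             p ℚ.≤ q → r ℚ.≤ s → p ℚ.* r ℚ.≤ q ℚ.* s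
  *-mono-≤ {q = q} {r = r} 0≤r 0≤q p≤q r≤s = ℚ.≤-trans
    (ℚ.*-monoʳ-≤-nonNeg r {{ℚ.nonNegative 0≤r}} p≤q)
    (ℚ.*-monoˡ-≤-nonNeg q {{ℚ.nonNegative 0≤q}} r≤s)

  ε½+ε½≡ε : ∀ ε → ε ℚ.* ½ ℚ.+ ε ℚ.* ½ ≡ ε
  ε½+ε½≡ε ε = trans (sym (ℚ.*-distribˡ-+ ε ½ ½)) (ℚ.*-identityʳ ε)

  module Identities where
    open +-*-Solver

    a≡a-b+b : ∀ a b → a ≡ (a ℚ.- b) ℚ.+ b
    a≡a-b+b = solve 2 (λ a b → a := (a :- b) :+ b) refl

    sum-diff : ∀ a b c d →
      (a ℚ.+ b) ℚ.- (c ℚ.+ d) ≡ (a ℚ.- c) ℚ.+ (b ℚ.- d)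
    sum-diff = solve 4 (λ a b c d →
      (a :+ b) :- (c :+ d) := (a :- c) :+ (b :- d)) refl

    product-diff : ∀ a b c d →
      a ℚ.* b ℚ.- c ℚ.* d ≡ a ℚ.* (b ℚ.- d) ℚ.+ (a ℚ.- c) ℚ.* d
    product-diff = solve 4 (λ a b c d →
      a :* b :- c :* d := a :* (b :- d) :+ (a :- c) :* d) refl

    collect : ∀ a b e r →
      a ℚ.* (e ℚ.* r) ℚ.+ e ℚ.* r ℚ.* b ≡ e ℚ.* ((a ℚ.+ b) ℚ.* r)
    collect = solve 4 (λ a b e r →
      a :* (e :* r) :+ e :* r :* b := e :* ((a :+ b) :* r)) refl

    recip-diff : ∀ a b r s →
      r ℚ.* (b ℚ.* s) ℚ.- s ℚ.* (a ℚ.* r) ≡ (b ℚ.- a) ℚ.* (r ℚ.* s)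
    recip-diff = solve 4 (λ a b r s →
      r :* (b :* s) :- s :* (a :* r) := (b :- a) :* (r :* s)) refl

    regroup : ∀ e d r s →
      e ℚ.* (d ℚ.* d) ℚ.* (r ℚ.* s) ≡ e ℚ.* ((d ℚ.* r) ℚ.* (d ℚ.* s))
    regroup = solve 4 (λ e d r s →
      e :* (d :* d) :* (r :* s) := e :* ((d :* r) :* (d :* s))) refl

  open Identities

  opaque
    const-cauchy : ∀ q → IsCauchy (λ _ → q)
    const-cauchy q ε 0<ε = 0 , λ _ _ _ _ → begin
      ∣ q ℚ.- q ∣ ≡⟨ cong ∣_∣ (ℚ.+-inverseʳ q) ⟩
      0ℚ          ≤⟨ ℚ.<⇒≤ 0<ε ⟩
      ε           ∎
      where open ℚ.≤-Reasoning

  opaque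
    +-cauchy : ∀ f g → IsCauchy f → IsCauchy g → IsCauchy (λ n → f n ℚ.+ g n)
    +-cauchy f g cf cg ε 0<ε
      with M , hM ← cf (ε ℚ.* ½) (0<* 0<ε 0<½)
         | N , hN ← cg (ε ℚ.* ½) (0<* 0<ε 0<½)
      = M ℕ.⊔ N , λ m n m≥ n≥ → begin
      ∣ (f m ℚ.+ g m) ℚ.- (f n ℚ.+ g n) ∣
        ≡⟨ cong ∣_∣ (sum-diff (f m) (g m) (f n) (g n)) ⟩
      ∣ (f m ℚ.- f n) ℚ.+ (g m ℚ.- g n) ∣
        ≤⟨ ℚ.∣p+q∣≤∣p∣+∣q∣ (f m ℚ.- f n) (g m ℚ.- g n) ⟩
      ∣ f m ℚ.- f n ∣ ℚ.+ ∣ g m ℚ.- g n ∣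
        ≤⟨ ℚ.+-mono-≤
             (hM m n (ℕ.m⊔n≤o⇒m≤o M N m≥) (ℕ.m⊔n≤o⇒m≤o M N n≥))
             (hN m n (ℕ.m⊔n≤o⇒n≤o M N m≥) (ℕ.m⊔n≤o⇒n≤o M N n≥)) ⟩
      ε ℚ.* ½ ℚ.+ ε ℚ.* ½
        ≡⟨ ε½+ε½≡ε ε ⟩
      ε ∎
      where open ℚ.≤-Reasoning

  opaque
    neg-cauchy : ∀ f → IsCauchy f → IsCauchy (λ n → ℚ.- f n)
    neg-cauchy f cf ε 0<ε with N , hN ← cf ε 0<ε = N , λ m n m≥ n≥ → begin
      ∣ ℚ.- f m ℚ.- ℚ.- f n ∣ ≡⟨ cong ∣_∣ (ℚ.neg-distrib-+ (f m) (ℚ.- f n)) ⟨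
      ∣ ℚ.- (f m ℚ.- f n) ∣   ≡⟨ ℚ.∣-p∣≡∣p∣ (f m ℚ.- f n) ⟩
      ∣ f m ℚ.- f n ∣         ≤⟨ hN m n m≥ n≥ ⟩
      ε                       ∎
      where open ℚ.≤-Reasoning

  opaque
    bounded : ∀ {f} → IsCauchy f →
      ∃[ B ] 0ℚ ℚ.< B × ∃[ N ] ∀ n → N ℕ.≤ n → ∣ f n ∣ ℚ.≤ B
    bounded {f} cf with N , hN ← cf 1ℚ (ℚ.positive⁻¹ 1ℚ) =
        1ℚ ℚ.+ ∣ f N ∣
      , ℚ.+-mono-<-≤ (ℚ.positive⁻¹ 1ℚ) (ℚ.0≤∣p∣ (f N))
      , N , λ n n≥ → begin
      ∣ f n ∣
        ≡⟨ cong ∣_∣ (a≡a-b+b (f n) (f N)) ⟩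
      ∣ (f n ℚ.- f N) ℚ.+ f N ∣
        ≤⟨ ℚ.∣p+q∣≤∣p∣+∣q∣ (f n ℚ.- f N) (f N) ⟩
      ∣ f n ℚ.- f N ∣ ℚ.+ ∣ f N ∣
        ≤⟨ ℚ.+-monoˡ-≤ ∣ f N ∣ (hN n N n≥ ℕ.≤-refl) ⟩
      1ℚ ℚ.+ ∣ f N ∣ ∎
      where open ℚ.≤-Reasoning

  opaque
    product-bound : ∀ a b c d {A B η} → 0ℚ ℚ.≤ A → 0ℚ ℚ.≤ η →
      ∣ a ∣ ℚ.≤ A → ∣ d ∣ ℚ.≤ B → ∣ a ℚ.- c ∣ ℚ.≤ η → ∣ b ℚ.- d ∣ ℚ.≤ η →
      ∣ a ℚ.* b ℚ.- c ℚ.* d ∣ ℚ.≤ A ℚ.* η ℚ.+ η ℚ.* B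
    product-bound a b c d {A} {B} {η} 0≤A 0≤η a≤A d≤B ac bd = begin
      ∣ a ℚ.* b ℚ.- c ℚ.* d ∣
        ≡⟨ cong ∣_∣ (product-diff a b c d) ⟩
      ∣ a ℚ.* (b ℚ.- d) ℚ.+ (a ℚ.- c) ℚ.* d ∣
        ≤⟨ ℚ.∣p+q∣≤∣p∣+∣q∣ (a ℚ.* (b ℚ.- d)) ((a ℚ.- c) ℚ.* d) ⟩
      ∣ a ℚ.* (b ℚ.- d) ∣ ℚ.+ ∣ (a ℚ.- c) ℚ.* d ∣
        ≡⟨ cong₂ ℚ._+_ (ℚ.∣p*q∣≡∣p∣*∣q∣ a (b ℚ.- d)) (ℚ.∣p*q∣≡∣p∣*∣q∣ (a ℚ.- c) d) ⟩
      ∣ a ∣ ℚ.* ∣ b ℚ.- d ∣ ℚ.+ ∣ a ℚ.- c ∣ ℚ.* ∣ d ∣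
        ≤⟨ ℚ.+-mono-≤ (*-mono-≤ (ℚ.0≤∣p∣ (b ℚ.- d)) 0≤A a≤A bd)
                      (*-mono-≤ (ℚ.0≤∣p∣ d) 0≤η ac d≤B) ⟩
      A ℚ.* η ℚ.+ η ℚ.* B ∎
      where open ℚ.≤-Reasoning

  opaque
    split-ε : ∀ A B ε → 0ℚ ℚ.< A → 0ℚ ℚ.< B → 0ℚ ℚ.< ε →
      ∃[ η ] 0ℚ ℚ.< η × A ℚ.* η ℚ.+ η ℚ.* B ≡ ε
    split-ε A B ε 0<A 0<B 0<ε =
        ε ℚ.* recip (A ℚ.+ B) , 0<* 0<ε (recip-pos (A ℚ.+ B) 0<A+B) , (begin
      A ℚ.* (ε ℚ.* recip (A ℚ.+ B)) ℚ.+ ε ℚ.* recip (A ℚ.+ B) ℚ.* B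
        ≡⟨ collect A B ε (recip (A ℚ.+ B)) ⟩
      ε ℚ.* ((A ℚ.+ B) ℚ.* recip (A ℚ.+ B))
        ≡⟨ cong (ε ℚ.*_) (recip-inverseʳ (A ℚ.+ B) (≢-sym (ℚ.<⇒≢ 0<A+B))) ⟩
      ε ℚ.* 1ℚ
        ≡⟨ ℚ.*-identityʳ ε ⟩
      ε ∎)
      where open ≡-Reasoning
            0<A+B : 0ℚ ℚ.< A ℚ.+ B
            0<A+B = ℚ.+-mono-< 0<A 0<B

  opaque
    *-cauchy : ∀ f g → IsCauchy f → IsCauchy g → IsCauchy (λ n → f n ℚ.* g n)
    *-cauchy f g cf cg ε 0<ε
      with A , 0<A , K , hK ← bounded cf
         | B , 0<B , L , hL ← bounded cg
      with η , 0<η , Aη+ηB≡ε ← split-ε A B ε 0<A 0<B 0<ε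
      with M , hM ← cf η 0<η
         | N , hN ← cg η 0<η
      = (K ℕ.⊔ L) ℕ.⊔ (M ℕ.⊔ N) , λ m n m≥ n≥ →
        let m≥KL = ℕ.m⊔n≤o⇒m≤o (K ℕ.⊔ L) (M ℕ.⊔ N) m≥
            n≥KL = ℕ.m⊔n≤o⇒m≤o (K ℕ.⊔ L) (M ℕ.⊔ N) n≥
            m≥MN = ℕ.m⊔n≤o⇒n≤o (K ℕ.⊔ L) (M ℕ.⊔ N) m≥
            n≥MN = ℕ.m⊔n≤o⇒n≤o (K ℕ.⊔ L) (M ℕ.⊔ N) n≥
        in subst (∣ f m ℚ.* g m ℚ.- f n ℚ.* g n ∣ ℚ.≤_) Aη+ηB≡ε
             (product-bound (f m) (g m) (f n) (g n) (ℚ.<⇒≤ 0<A) (ℚ.<⇒≤ 0<η)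
               (hK m (ℕ.m⊔n≤o⇒m≤o K L m≥KL))
               (hL n (ℕ.m⊔n≤o⇒n≤o K L n≥KL))
               (hM m n (ℕ.m⊔n≤o⇒m≤o M N m≥MN) (ℕ.m⊔n≤o⇒m≤o M N n≥MN))
               (hN m n (ℕ.m⊔n≤o⇒n≤o M N m≥MN) (ℕ.m⊔n≤o⇒n≤o M N n≥MN)))

  opaque
    δ*recip≤1 : ∀ {δ q} → 0ℚ ℚ.< δ → δ ℚ.≤ q → δ ℚ.* recip q ℚ.≤ 1ℚ
    δ*recip≤1 {δ} {q} 0<δ δ≤q = begin
      δ ℚ.* recip q ≤⟨ ℚ.*-monoʳ-≤-nonNeg (recip q) {{ℚ.nonNegative (ℚ.<⇒≤ (recip-pos q 0<q))}} δ≤q ⟩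
      q ℚ.* recip q ≡⟨ recip-inverseʳ q (≢-sym (ℚ.<⇒≢ 0<q)) ⟩
      1ℚ            ∎
      where open ℚ.≤-Reasoning
            0<q : 0ℚ ℚ.< q
            0<q = ℚ.<-≤-trans 0<δ δ≤q

  opaque
    recip-diff-bound : ∀ a b r s δ ε → 0ℚ ℚ.< δ → 0ℚ ℚ.< ε →
      0ℚ ℚ.< r → 0ℚ ℚ.< s → a ℚ.* r ≡ 1ℚ → b ℚ.* s ≡ 1ℚ →
      δ ℚ.* r ℚ.≤ 1ℚ → δ ℚ.* s ℚ.≤ 1ℚ →
      ∣ b ℚ.- a ∣ ℚ.≤ ε ℚ.* (δ ℚ.* δ) → ∣ r ℚ.- s ∣ ℚ.≤ ε
    recip-diff-bound a b r s δ ε 0<δ 0<ε 0<r 0<s ar≡1 bs≡1 δr≤1 δs≤1 h = begin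
      ∣ r ℚ.- s ∣
        ≡⟨ cong ∣_∣ (cong₂ ℚ._-_ (ℚ.*-identityʳ r) (ℚ.*-identityʳ s)) ⟨
      ∣ r ℚ.* 1ℚ ℚ.- s ℚ.* 1ℚ ∣
        ≡⟨ cong ∣_∣ (cong₂ (λ u v → r ℚ.* u ℚ.- s ℚ.* v) bs≡1 ar≡1) ⟨
      ∣ r ℚ.* (b ℚ.* s) ℚ.- s ℚ.* (a ℚ.* r) ∣
        ≡⟨ cong ∣_∣ (recip-diff a b r s) ⟩
      ∣ (b ℚ.- a) ℚ.* (r ℚ.* s) ∣
        ≡⟨ ℚ.∣p*q∣≡∣p∣*∣q∣ (b ℚ.- a) (r ℚ.* s) ⟩
      ∣ b ℚ.- a ∣ ℚ.* ∣ r ℚ.* s ∣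
        ≡⟨ cong (∣ b ℚ.- a ∣ ℚ.*_) (ℚ.0≤p⇒∣p∣≡p 0≤rs) ⟩
      ∣ b ℚ.- a ∣ ℚ.* (r ℚ.* s)
        ≤⟨ ℚ.*-monoʳ-≤-nonNeg (r ℚ.* s) {{ℚ.nonNegative 0≤rs}} h ⟩
      ε ℚ.* (δ ℚ.* δ) ℚ.* (r ℚ.* s)
        ≡⟨ regroup ε δ r s ⟩
      ε ℚ.* ((δ ℚ.* r) ℚ.* (δ ℚ.* s))
        ≤⟨ ℚ.*-monoˡ-≤-nonNeg ε {{ℚ.nonNegative (ℚ.<⇒≤ 0<ε)}}
             (*-mono-≤ (ℚ.<⇒≤ (0<* 0<δ 0<s)) (ℚ.<⇒≤ (ℚ.positive⁻¹ 1ℚ)) δr≤1 δs≤1) ⟩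
      ε ℚ.* (1ℚ ℚ.* 1ℚ)
        ≡⟨ ℚ.*-identityʳ ε ⟩
      ε ∎
      where open ℚ.≤-Reasoning
            0≤rs : 0ℚ ℚ.≤ r ℚ.* s
            0≤rs = ℚ.<⇒≤ (0<* 0<r 0<s)

  opaque
    recip-cauchy : ∀ f → IsCauchy f → ∀ δ → 0ℚ ℚ.< δ →
      ∀ K → (∀ n → K ℕ.≤ n → δ ℚ.≤ f n) → IsCauchy (λ n → recip (f n))
    recip-cauchy f cf δ 0<δ K hK ε 0<ε
      with N , hN ← cf (ε ℚ.* (δ ℚ.* δ)) (0<* 0<ε (0<* 0<δ 0<δ))
      = K ℕ.⊔ N , λ m n m≥ n≥ →
        let δ≤a = hK m (ℕ.m⊔n≤o⇒m≤o K N m≥)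
            δ≤b = hK n (ℕ.m⊔n≤o⇒m≤o K N n≥)
            0<a = ℚ.<-≤-trans 0<δ δ≤a
            0<b = ℚ.<-≤-trans 0<δ δ≤b
        in recip-diff-bound (f m) (f n) (recip (f m)) (recip (f n)) δ ε 0<δ 0<ε
             (recip-pos (f m) 0<a) (recip-pos (f n) 0<b)
             (recip-inverseʳ (f m) (≢-sym (ℚ.<⇒≢ 0<a))) (recip-inverseʳ (f n) (≢-sym (ℚ.<⇒≢ 0<b)))
             (δ*recip≤1 0<δ δ≤a) (δ*recip≤1 0<δ δ≤b)
             (hN n m (ℕ.m⊔n≤o⇒n≤o K N n≥) (ℕ.m⊔n≤o⇒n≤o K N m≥))

fromℚ : ℚ → ℝ
fromℚ q = mkℝ (λ _ → q) (const-cauchy q)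

fromℕ : ℕ → ℝ
fromℕ n = fromℚ (+ n / 1)

_+_ : ℝ → ℝ → ℝ
x + y = mkℝ (λ n → seq x n ℚ.+ seq y n) (+-cauchy (seq x) (seq y) (cauchy x) (cauchy y))

-_ : ℝ → ℝ
- x = mkℝ (λ n → ℚ.- seq x n) (neg-cauchy (seq x) (cauchy x))

_-_ : ℝ → ℝ → ℝ
x - y = x + (- y)

_*_ : ℝ → ℝ → ℝ
x * y = mkℝ (λ n → seq x n ℚ.* seq y n) (*-cauchy (seq x) (seq y) (cauchy x) (cauchy y))

-- The terms before the lower bound takes effect may be 0; they do not
-- affect the limit.
inv : (x : ℝ) → fromℕ 0 < x → ℝ
inv x (δ , 0<δ , N , h) = mkℝ (λ n → recip (seq x n))
  (recip-cauchy (seq x) (cauchy x) δ 0<δ N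
    (λ n n≥ → subst (ℚ._≤ seq x n) (ℚ.+-identityˡ δ) (h n n≥)))

-- A relation, since a bounded family of reals need not have a supremum
-- constructively; it determines s up to equality of reals.
IsSupremum : {I : Set} → (I → ℝ) → ℝ → Set
IsSupremum f s = (∀ i → f i ≤ s) × (∀ u → (∀ i → f i ≤ u) → s ≤ u)

------------------------------------------------------------------------
-- Ski rental with purchase price p

-- The cost incurred by a deterministic algorithm, as a function of the
-- number x of days skied.
Cost : Set
Cost = ℕ → ℕ

A : (p b : ℕ) → Cost
A p b x = if ⌊ x ℕ.≤? b ⌋ then x else b ℕ.+ p

opt : (p : ℕ) → Cost
opt p x = x ℕ.⊓ p

opt-nonZero : ∀ p x → .{{NonTrivial p}} → .{{NonZero x}} → NonZero (opt p x)
opt-nonZero (suc _) (suc _) = _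

ratio : (p : ℕ) .{{_ : NonTrivial p}} → Cost → (x : ℕ) .{{_ : NonZero x}} → ℝ
ratio p c x = fromℚ ((+ c x / opt p x) {{opt-nonZero p x}})

IsCompetitiveRatio : (p : ℕ) .{{_ : NonTrivial p}} → Cost → ℝ → Set
IsCompetitiveRatio p c =
  IsSupremum {I = Σ ℕ NonZero} (λ (x , x≢0) → ratio p c x {{x≢0}})

2φ-1 : ℝ → ℝ
2φ-1 φ = fromℕ 2 * φ - fromℕ 1

private
  opaque
    double-minus : ∀ q →
      (+ 2 / 1) ℚ.* (q ℚ.+ ½ ℚ.* ½) ℚ.- (1ℚ ℚ.+ ½) ≡ (+ 2 / 1) ℚ.* q ℚ.- 1ℚ
    double-minus = solve 1 (λ q →
      con (+ 2 / 1) :* (q :+ con (½ ℚ.* ½)) :- con (1ℚ ℚ.+ ½)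
        := con (+ 2 / 1) :* q :- con 1ℚ) refl
      where open +-*-Solver

    ½≤2q-1 : ∀ q → 1ℚ ℚ.≤ q ℚ.+ ½ ℚ.* ½ →
      0ℚ ℚ.+ ½ ℚ.≤ (+ 2 / 1) ℚ.* q ℚ.- 1ℚ
    ½≤2q-1 q h = subst (0ℚ ℚ.+ ½ ℚ.≤_) (double-minus q)
      (ℚ.+-monoˡ-≤ (ℚ.- (1ℚ ℚ.+ ½)) (ℚ.*-monoˡ-≤-nonNeg (+ 2 / 1) h))

2φ-1-pos : ∀ φ → fromℕ 1 ≤ φ → fromℕ 0 < 2φ-1 φ
2φ-1-pos φ 1≤φ with N , h ← 1≤φ (½ ℚ.* ½) (ℚ.positive⁻¹ (½ ℚ.* ½)) =
  ½ , 0<½ , N , λ n n≥ → ½≤2q-1 (seq φ n) (h n n≥)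

-- The closed interval [ p/(2φ-1) , p(2φ-1) ]; the hypothesis 1 ≤ φ makes
-- the division legitimate.
𝓑 : ℕ → (φ : ℝ) → fromℕ 1 ≤ φ → Pred ℝ 0ℓ
𝓑 p φ 1≤φ r =
    fromℕ p * inv (2φ-1 φ) (2φ-1-pos φ 1≤φ) ≤ r
  × r ≤ fromℕ p * 2φ-1 φ

{-# OPTIONS --safe #-}

-- The ratio of A(b) is maximal at x = b + 1, where it equals (b+p)/min(b+1,p);
-- for the baseline b = p this is 2.  So the claim is (b+p)/min(b+1,p) ≤ 2φ, which
-- is b/p ≤ 2φ-1 when p ≤ b + 1, and follows from p/b ≤ 2φ-1 when b + 1 ≤ p.
module Submission where

open import Data.Integer.Base as ℤ using (+_)
import Data.Integer.Properties as ℤ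
open import Data.Nat.Base as ℕ using (ℕ; suc; NonZero; NonTrivial; _⊓_)
import Data.Nat.Properties as ℕ
open import Data.Product.Base using (∃-syntax; _×_; _,_)
open import Data.Rational.Base as ℚ using (ℚ; 0ℚ; 1ℚ; _/_; toℚᵘ)
import Data.Rational.Properties as ℚ
open import Data.Rational.Solver using (module +-*-Solver)
open import Data.Rational.Unnormalised.Base as ℚᵘ using (mkℚᵘ)
import Data.Rational.Unnormalised.Properties as ℚᵘ
open import Data.Sum.Base using (inj₁; inj₂)
open import Function.Base using (it)
open import Relation.Binary.PropositionalEquality
open import Relation.Nullary.Decidable using (yes; no)
open import Relation.Nullary.Negation using (contradiction)
open import Relation.Unary using (_∈_)
open import Defs

-- The operation `/` reduces to lowest terms, so the numerator and denominator of the result are not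
-- `m` and `c`. On unnormalised rationals they are, and there the order is cross-multiplication.
/-mono-≤ : ∀ m n c d .{{_ : NonZero c}} .{{_ : NonZero d}} →
  m ℕ.* d ℕ.≤ n ℕ.* c → (+ m / c) ℚ.≤ (+ n / d)
/-mono-≤ m n c@(suc c-1) d@(suc d-1) md≤nc = ℚ.toℚᵘ-cancel-≤ (begin
  toℚᵘ (+ m / c)   ≃⟨ ℚ.toℚᵘ-fromℚᵘ (mkℚᵘ (+ m) c-1) ⟩
  mkℚᵘ (+ m) c-1   ≤⟨ ℚᵘ.*≤* (subst₂ ℤ._≤_ (ℤ.pos-* m d) (ℤ.pos-* n c) (ℤ.+≤+ md≤nc)) ⟩
  mkℚᵘ (+ n) d-1   ≃⟨ ℚ.toℚᵘ-fromℚᵘ (mkℚᵘ (+ n) d-1) ⟨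
  toℚᵘ (+ n / d)   ∎)
  where open ℚᵘ.≤-Reasoning

/-cong-* : ∀ m n c d .{{_ : NonZero c}} .{{_ : NonZero d}} →
  m ℕ.* d ≡ n ℕ.* c → (+ m / c) ≡ (+ n / d)
/-cong-* m n c d eq = ℚ.≤-antisym
  (/-mono-≤ m n c d (ℕ.≤-reflexive eq))
  (/-mono-≤ n m d c (ℕ.≤-reflexive (sym eq)))

-- Chosen so that every term of the constant sequence `fromℕ n` is `ι n` by definition; the interval
-- bounds then read termwise as inequalities between such rationals.
ι : ℕ → ℚ
ι n = + n / 1

ι-mono-≤ : ∀ {m n} → m ℕ.≤ n → ι m ℚ.≤ ι n
ι-mono-≤ {m} {n} m≤n = /-mono-≤ m n 1 1 (ℕ.*-monoˡ-≤ 1 m≤n)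

ι-+ : ∀ m n → ι (m ℕ.+ n) ≡ ι m ℚ.+ ι n
ι-+ m n = ℚ.toℚᵘ-injective (begin
  toℚᵘ (ι (m ℕ.+ n))                ≈⟨ ℚ.toℚᵘ-fromℚᵘ (mkℚᵘ (+ (m ℕ.+ n)) 0) ⟩
  mkℚᵘ (+ (m ℕ.+ n)) 0              ≡⟨ cong (λ i → mkℚᵘ i 0) numerators ⟩
  mkℚᵘ (+ m) 0 ℚᵘ.+ mkℚᵘ (+ n) 0    ≈⟨ ℚᵘ.+-cong (ℚ.toℚᵘ-fromℚᵘ (mkℚᵘ (+ m) 0)) (ℚ.toℚᵘ-fromℚᵘ (mkℚᵘ (+ n) 0)) ⟨
  toℚᵘ (ι m) ℚᵘ.+ toℚᵘ (ι n)        ≈⟨ ℚ.toℚᵘ-homo-+ (ι m) (ι n) ⟨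
  toℚᵘ (ι m ℚ.+ ι n)                ∎)
  where
  open ℚᵘ.≃-Reasoning
  numerators : + (m ℕ.+ n) ≡ + m ℤ.* + 1 ℤ.+ + n ℤ.* + 1
  numerators = trans (ℤ.pos-+ m n)
    (sym (cong₂ ℤ._+_ (ℤ.*-identityʳ (+ m)) (ℤ.*-identityʳ (+ n))))

/-*-ι : ∀ m d .{{_ : NonZero d}} → (+ m / d) ℚ.* ι d ≡ ι m
/-*-ι m d@(suc d-1) = ℚ.toℚᵘ-injective (begin
  toℚᵘ ((+ m / d) ℚ.* ι d)            ≈⟨ ℚ.toℚᵘ-homo-* (+ m / d) (ι d) ⟩
  toℚᵘ (+ m / d) ℚᵘ.* toℚᵘ (ι d)      ≈⟨ ℚᵘ.*-cong (ℚ.toℚᵘ-fromℚᵘ (mkℚᵘ (+ m) d-1)) (ℚ.toℚᵘ-fromℚᵘ (mkℚᵘ (+ d) 0)) ⟩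
  mkℚᵘ (+ m) d-1 ℚᵘ.* mkℚᵘ (+ d) 0    ≈⟨ ℚᵘ.*≡* cross ⟩
  mkℚᵘ (+ m) 0                        ≈⟨ ℚ.toℚᵘ-fromℚᵘ (mkℚᵘ (+ m) 0) ⟨
  toℚᵘ (ι m)                          ∎)
  where
  open ℚᵘ.≃-Reasoning
  cross : + m ℤ.* + d ℤ.* + 1 ≡ + m ℤ.* + (d ℕ.* 1)
  cross = trans (ℤ.*-identityʳ _) (cong (λ k → + m ℤ.* + k) (sym (ℕ.*-identityʳ d)))

/-≤ : ∀ m d t .{{_ : NonZero d}} → ι m ℚ.≤ t ℚ.* ι d → (+ m / d) ℚ.≤ t
/-≤ m d t h = ℚ.*-cancelʳ-≤-pos (ι d) {{ℚ.normalize-pos d 1}}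
  (subst (ℚ._≤ t ℚ.* ι d) (sym (/-*-ι m d)) h)

≤-+-nonNeg : ∀ {q r} ε → 0ℚ ℚ.≤ ε → q ℚ.≤ r → q ℚ.≤ r ℚ.+ ε
≤-+-nonNeg {q} {r} ε 0≤ε q≤r = subst (ℚ._≤ r ℚ.+ ε) (ℚ.+-identityʳ q) (ℚ.+-mono-≤ q≤r 0≤ε)

-- An upper bound of the family bounds in particular its value at `i`. Exhibiting a maximiser thus
-- sidesteps the constructive existence of suprema.
supremum-attained : {I : Set} (g : I → ℚ) (i : I) →
  (∀ j → g j ℚ.≤ g i) → IsSupremum (λ j → fromℚ (g j)) (fromℚ (g i))
supremum-attained g i g≤gi =
    (λ j ε 0<ε → 0 , λ _ _ → ≤-+-nonNeg ε (ℚ.<⇒≤ 0<ε) (g≤gi j))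
  , λ u g≤u → g≤u i

A-after : ∀ p b {x} → b ℕ.< x → A p b x ≡ b ℕ.+ p
A-after p b {x} b<x with x ℕ.≤? b
... | yes x≤b = contradiction x≤b (ℕ.<⇒≱ b<x)
... | no  _   = refl

-- Comparison of the ratios at `x` and `suc b`, cross-multiplied so that it stays within ℕ.
A-ratio-max : ∀ p b x →
  A p b x ℕ.* opt p (suc b) ℕ.≤ (b ℕ.+ p) ℕ.* opt p x
A-ratio-max p b x with x ℕ.≤? b
-- After the purchase the cost is constant while the optimum can only grow, so the first such day is
-- the worst.
... | no  x≰b = ℕ.*-monoʳ-≤ (b ℕ.+ p) (ℕ.⊓-monoˡ-≤ p (ℕ.≰⇒> x≰b))
... | yes x≤b with ℕ.≤-total x p
-- Here the ratio at `x` is 1, and the one at `suc b` is at least 1.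
...   | inj₁ x≤p = begin
  x ℕ.* (suc b ⊓ p)       ≡⟨ ℕ.*-comm x (suc b ⊓ p) ⟩
  (suc b ⊓ p) ℕ.* x       ≤⟨ ℕ.*-monoˡ-≤ x (ℕ.≤-trans (ℕ.m⊓n≤n (suc b) p) (ℕ.m≤n+m p b)) ⟩
  (b ℕ.+ p) ℕ.* x         ≡⟨ cong ((b ℕ.+ p) ℕ.*_) (ℕ.m≤n⇒m⊓n≡m x≤p) ⟨
  (b ℕ.+ p) ℕ.* (x ⊓ p)   ∎
  where open ℕ.≤-Reasoning
-- Here the optimum is `p`, and numerators and denominators compare separately.
...   | inj₂ p≤x = begin
  x ℕ.* (suc b ⊓ p)       ≤⟨ ℕ.*-mono-≤ (ℕ.≤-trans x≤b (ℕ.m≤m+n b p)) (ℕ.m⊓n≤n (suc b) p) ⟩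
  (b ℕ.+ p) ℕ.* p         ≡⟨ cong ((b ℕ.+ p) ℕ.*_) (ℕ.m≥n⇒m⊓n≡n p≤x) ⟨
  (b ℕ.+ p) ℕ.* (x ⊓ p)   ∎
  where open ℕ.≤-Reasoning

maxRatio : (p b : ℕ) .{{_ : NonTrivial p}} → ℚ
maxRatio p b = (+ (b ℕ.+ p) / opt p (suc b)) {{opt-nonZero p (suc b)}}

A-competitiveRatio : ∀ p b .{{_ : NonTrivial p}} →
  IsCompetitiveRatio p (A p b) (fromℚ (maxRatio p b))
-- For a variable `b` the test `suc b ≤? b` does not compute, so the cost at the maximiser has to be
-- rewritten to `b + p`.
A-competitiveRatio p b = subst (λ c → IsCompetitiveRatio p (A p b)
    (fromℚ ((+ c / opt p (suc b)) {{opt-nonZero p (suc b)}}))) (A-after p b ℕ.≤-refl)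
  (supremum-attained
    (λ (x , x≢0) → (+ A p b x / opt p x) {{opt-nonZero p x {{it}} {{x≢0}}}})
    (suc b , _)
    λ (x , x≢0) → /-mono-≤ (A p b x) (A p b (suc b)) (opt p x) (opt p (suc b))
      {{opt-nonZero p x {{it}} {{x≢0}}}} {{opt-nonZero p (suc b)}}
      (subst (λ c → A p b x ℕ.* opt p (suc b) ℕ.≤ c ℕ.* opt p x)
        (sym (A-after p b ℕ.≤-refl)) (A-ratio-max p b x)))

maxRatio-baseline : ∀ p .{{_ : NonTrivial p}} → maxRatio p p ≡ ι 2
maxRatio-baseline p = /-cong-* (p ℕ.+ p) 2 (suc p ⊓ p) 1 {{opt-nonZero p (suc p)}} (begin
  (p ℕ.+ p) ℕ.* 1       ≡⟨ ℕ.*-identityʳ (p ℕ.+ p) ⟩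
  p ℕ.+ p               ≡⟨ cong (p ℕ.+_) (ℕ.+-identityʳ p) ⟨
  2 ℕ.* p               ≡⟨ cong (2 ℕ.*_) (ℕ.m≥n⇒m⊓n≡n (ℕ.n≤1+n p)) ⟨
  2 ℕ.* (suc p ⊓ p)     ∎)
  where open ≡-Reasoning

-- The parameter `d` is the value of the minimum, so that each case can supply `p` or `suc b`
-- directly.
maxRatio-≤ : ∀ p b t d .{{_ : NonTrivial p}} → opt p (suc b) ≡ d →
  ι b ℚ.+ ι p ℚ.≤ t ℚ.* ι d → maxRatio p b ℚ.≤ t
maxRatio-≤ p b t d refl h = /-≤ (b ℕ.+ p) (opt p (suc b)) t {{opt-nonZero p (suc b)}}
  (subst (ℚ._≤ t ℚ.* ι d) (sym (ι-+ b p)) h)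

*recip-≤ : ∀ {P t B} → 0ℚ ℚ.< t → P ℚ.* recip t ℚ.≤ B → P ℚ.≤ B ℚ.* t
*recip-≤ {P} {t} {B} 0<t h = begin
  P                        ≡⟨ ℚ.*-identityʳ P ⟨
  P ℚ.* 1ℚ                 ≡⟨ cong (P ℚ.*_) (recip-inverseʳ t (≢-sym (ℚ.<⇒≢ 0<t))) ⟨
  P ℚ.* (t ℚ.* recip t)    ≡⟨ cong (P ℚ.*_) (ℚ.*-comm t (recip t)) ⟩
  P ℚ.* (recip t ℚ.* t)    ≡⟨ ℚ.*-assoc P (recip t) t ⟨
  P ℚ.* recip t ℚ.* t      ≤⟨ ℚ.*-monoʳ-≤-nonNeg t {{ℚ.nonNegative (ℚ.<⇒≤ 0<t)}} h ⟩
  B ℚ.* t                  ∎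
  where open ℚ.≤-Reasoning

module _ where
  open +-*-Solver

  late-identity : ∀ P q ε → P ℚ.* (ι 2 ℚ.* q ℚ.- 1ℚ) ℚ.+ ε ℚ.+ P ≡ q ℚ.* ι 2 ℚ.* P ℚ.+ ε
  late-identity = solve 3 (λ P q ε →
    P :* (con (ι 2) :* q :- con 1ℚ) :+ ε :+ P := q :* con (ι 2) :* P :+ ε) refl

  early-identity : ∀ B q → B ℚ.+ (B ℚ.+ 1ℚ) ℚ.* (ι 2 ℚ.* q ℚ.- 1ℚ) ℚ.+ 1ℚ ≡ q ℚ.* ι 2 ℚ.* (1ℚ ℚ.+ B)
  early-identity = solve 2 (λ B q →
    B :+ (B :+ con 1ℚ) :* (con (ι 2) :* q :- con 1ℚ) :+ con 1ℚ
      := q :* con (ι 2) :* (con 1ℚ :+ B)) refl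

-- The minimum is `p`, and adding `p` to the upper endpoint `p(2q - 1)` gives `2qp`. Here `q` stands
-- for a term of the sequence `φ`.
maxRatio-late : ∀ p b q ε .{{_ : NonTrivial p}} → p ℕ.≤ suc b → 0ℚ ℚ.≤ ε →
  ι b ℚ.≤ ι p ℚ.* (ι 2 ℚ.* q ℚ.- 1ℚ) ℚ.+ ε → maxRatio p b ℚ.≤ q ℚ.* ι 2 ℚ.+ ε
maxRatio-late p b q ε p≤1+b 0≤ε h =
  maxRatio-≤ p b (q ℚ.* ι 2 ℚ.+ ε) p (ℕ.m≥n⇒m⊓n≡n p≤1+b) (begin
    ι b ℚ.+ ι p
      ≤⟨ ℚ.+-monoˡ-≤ (ι p) h ⟩
    ι p ℚ.* (ι 2 ℚ.* q ℚ.- 1ℚ) ℚ.+ ε ℚ.+ ι p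
      ≡⟨ late-identity (ι p) q ε ⟩
    q ℚ.* ι 2 ℚ.* ι p ℚ.+ ε
      ≡⟨ cong (q ℚ.* ι 2 ℚ.* ι p ℚ.+_) (ℚ.*-identityʳ ε) ⟨
    q ℚ.* ι 2 ℚ.* ι p ℚ.+ ε ℚ.* 1ℚ
      ≤⟨ ℚ.+-monoʳ-≤ (q ℚ.* ι 2 ℚ.* ι p)
           (ℚ.*-monoˡ-≤-nonNeg ε {{ℚ.nonNegative 0≤ε}} (ι-mono-≤ (ℕ.>-nonZero⁻¹ p {{ℕ.nonTrivial⇒nonZero p}}))) ⟩
    q ℚ.* ι 2 ℚ.* ι p ℚ.+ ε ℚ.* ι p
      ≡⟨ ℚ.*-distribʳ-+ (ι p) (q ℚ.* ι 2) ε ⟨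
    (q ℚ.* ι 2 ℚ.+ ε) ℚ.* ι p ∎)
  where open ℚ.≤-Reasoning

-- From `p ≤ (b + 1)(2q - 1)` follows `b + p ≤ 2q(b + 1) - 1`. The tolerance 1 in the hypothesis is
-- absorbed by the minimum `b + 1`, so the conclusion carries none.
maxRatio-early : ∀ p b q .{{_ : NonTrivial p}} → suc b ℕ.≤ p → 0ℚ ℚ.< ι 2 ℚ.* q ℚ.- 1ℚ →
  ι p ℚ.* recip (ι 2 ℚ.* q ℚ.- 1ℚ) ℚ.≤ ι b ℚ.+ 1ℚ → maxRatio p b ℚ.≤ q ℚ.* ι 2
maxRatio-early p b q 1+b≤p 0<t h =
  maxRatio-≤ p b (q ℚ.* ι 2) (suc b) (ℕ.m≤n⇒m⊓n≡m 1+b≤p) (begin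
    ι b ℚ.+ ι p
      ≤⟨ ≤-+-nonNeg 1ℚ (ℚ.<⇒≤ (ℚ.positive⁻¹ 1ℚ)) (ℚ.+-monoʳ-≤ (ι b) (*recip-≤ 0<t h)) ⟩
    ι b ℚ.+ (ι b ℚ.+ 1ℚ) ℚ.* (ι 2 ℚ.* q ℚ.- 1ℚ) ℚ.+ 1ℚ
      ≡⟨ early-identity (ι b) q ⟩
    q ℚ.* ι 2 ℚ.* (1ℚ ℚ.+ ι b)
      ≡⟨ cong (q ℚ.* ι 2 ℚ.*_) (ι-+ 1 b) ⟨
    q ℚ.* ι 2 ℚ.* ι (suc b) ∎)
  where open ℚ.≤-Reasoning

corollary2p2 : (p : ℕ) .{{_ : NonTrivial p}} →
    (φ : ℝ) (1≤φ : fromℕ 1 ≤ φ) →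
    (b : ℕ) .{{_ : NonZero b}} →
    fromℕ b ∈ 𝓑 p φ 1≤φ →
    ∃[ CRb ] ∃[ CRp ]
    IsCompetitiveRatio p (A p b) CRb ×
    IsCompetitiveRatio p (A p p) CRp ×
    CRb ≤ φ * CRp
corollary2p2 p φ 1≤φ b (lower , upper) =
    fromℚ (maxRatio p b) , fromℕ 2
  , A-competitiveRatio p b
  , subst (λ r → IsCompetitiveRatio p (A p p) (fromℚ r)) (maxRatio-baseline p) (A-competitiveRatio p p)
  , bound
  where
  bound : fromℚ (maxRatio p b) ≤ φ * fromℕ 2
  bound ε 0<ε with ℕ.≤-total p (suc b)
  ... | inj₁ p≤1+b with N , h ← upper ε 0<ε =
    N , λ n n≥ → maxRatio-late p b (seq φ n) ε p≤1+b (ℚ.<⇒≤ 0<ε) (h n n≥)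
  ... | inj₂ 1+b≤p
    -- ε = 1 suffices, since the denominator is b + 1 and not b.
    with N , h ← lower 1ℚ (ℚ.positive⁻¹ 1ℚ)
       | δ , 0<δ , M , δ≤ ← 2φ-1-pos φ 1≤φ
    -- From `M` on, the terms of `2φ-1 φ` are at least `δ`, so `recip` is a true inverse there and
    -- not the default 0; from `N` on, the bound from the lower endpoint holds.
    = M ℕ.⊔ N , λ n n≥ → ≤-+-nonNeg ε (ℚ.<⇒≤ 0<ε) (maxRatio-early p b (seq φ n) 1+b≤p
        (ℚ.<-≤-trans 0<δ (subst (ℚ._≤ _) (ℚ.+-identityˡ δ) (δ≤ n (ℕ.m⊔n≤o⇒m≤o M N n≥))))
        (h n (ℕ.m⊔n≤o⇒n≤o M N n≥)))
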